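{- Let $k,s$ be integers with $k\geq 3$ and $s\geq 2$. Then: (1) $\mathrm{GR}_{3}(\vee_2:\mathcal{C}_s)=2s-1$. (2) The pair $(\vee_2,\mathcal{C}_s)$ is $(\vee_2:\mathcal{C}_s)_4$-good for $s\in\{2,3\}$, and $\mathrm{GR}_{4}(\vee_2:\mathcal{C}_s)=s$ for all $s\geq 4$. (3) If $k\geq 5$, the pair $(\vee_2,\mathcal{C}_s)$ is $(\vee_2:\mathcal{C}_s)_k$-good.
   Context: $\mathcal{B}_N$ denotes the Boolean lattice of all subsets of $[N]$ ordered by inclusion. For posets $\mathcal{P},\mathcal{Q}$, an induced copy of $\mathcal{P}$ in $\mathcal{Q}$ is the image of an injection $f:\mathcal{P}\to\mathcal{Q}$ with $f(X)\le f(Y)$ iff $X\le Y$. $\mathcal{C}_t$ is the $t$-element chain. $\vee_2$ is the poset on three elements $X_0,X_1,X_2$ with $X_0<X_1$, $X_0<X_2$ and $X_1,X_2$ incomparable. A $k$-coloring of $\mathcal{B}_N$ is exact if it uses colors from $[k]$ and every color is used at least once. Monochromatic: all sets share one color; rainbow: all sets have pairwise distinct colors. The pair $(\mathcal{Q},\mathcal{P})$ is $(\mathcal{Q}:\mathcal{P})_k$-good if for every positive integer $N$, every exact $k$-coloring of $\mathcal{B}_N$ contains a rainbow induced copy of $\mathcal{Q}$ or a monochromatic induced copy of $\mathcal{P}$. For a pair that is not good, $\mathrm{GR}_k(\mathcal{Q}:\mathcal{P})$ is the smallest integer $n$ such that for every $N\ge n$, every exact $k$-coloring of $\mathcal{B}_N$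 contains a rainbow induced copy of $\mathcal{Q}$ or a monochromatic induced copy of $\mathcal{P}$. -}

module Defs where

open import Data.Fin using (Fin)
open import Data.Fin.Properties using (≤-poset)
open import Data.Fin.Subset using (Subset)
open import Data.Fin.Subset.Properties using (⊆-poset)
open import Data.Nat using (ℕ; _≤_; _≥_)
open import Data.Product using (_×_; ∃-syntax)
open import Data.Sum using (_⊎_)
open import Function.Definitions using (StrictlySurjective)
open import Level using (0ℓ)
open import Relation.Binary.Bundles using (Poset)
open import Relation.Binary.Morphism.Structures using (IsOrderMonomorphism)
open import Relation.Binary.PropositionalEquality using (_≡_; _≢_; refl; isEquivalence)
open import Relation.Nullary using (¬_)

𝓑 : ℕ → Poset 0ℓ 0ℓ 0ℓ
𝓑 N = ⊆-poset N

𝓒 : ℕ → Poset 0ℓ 0ℓ 0ℓ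
𝓒 t = ≤-poset t

data V : Set where
  X₀ X₁ X₂ : V

data _≤V_ : V → V → Set where
  ≤V-refl : ∀ {x} → x ≤V x
  X₀≤X₁   : X₀ ≤V X₁
  X₀≤X₂   : X₀ ≤V X₂

∨₂ : Poset 0ℓ 0ℓ 0ℓ
∨₂ = record
  { Carrier        = V
  ; _≈_            = _≡_
  ; _≤_            = _≤V_
  ; isPartialOrder = record
    { isPreorder = record
      { isEquivalence = isEquivalence
      ; reflexive     = λ { refl → ≤V-refl }
      ; trans         = trans
      }
    ; antisym = antisym
    }
  }
  where
  trans : ∀ {x y z} → x ≤V y → y ≤V z → x ≤V z
  trans ≤V-refl q       = q
  trans X₀≤X₁   ≤V-refl = X₀≤X₁
  trans X₀≤X₂   ≤V-refl = X₀≤X₂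

  antisym : ∀ {x y} → x ≤V y → y ≤V x → x ≡ y
  antisym ≤V-refl _ = refl

-- The fields `mono` and `cancel` of IsOrderMonomorphism are the two directions of
-- X ≤ Y ⇔ f X ≤ f Y.  The copy itself is the image of ⟦_⟧.
record InducedCopy (P Q : Poset 0ℓ 0ℓ 0ℓ) : Set where
  private
    module P = Poset P
    module Q = Poset Q
  field
    ⟦_⟧                 : P.Carrier → Q.Carrier
    isOrderMonomorphism : IsOrderMonomorphism P._≈_ Q._≈_ P._≤_ Q._≤_ ⟦_⟧

Coloring : ℕ → ℕ → Set
Coloring k N = Subset N → Fin k

Exact : ∀ {k N} → Coloring k N → Set
Exact c = StrictlySurjective _≡_ c

module _ {k N : ℕ} (c : Coloring k N) (P : Poset 0ℓ 0ℓ 0ℓ) where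
  open Poset P using (Carrier; _≈_)
  open InducedCopy using (⟦_⟧)

  Monochromatic : InducedCopy P (𝓑 N) → Set
  Monochromatic f = ∃[ i ] (∀ (x : Carrier) → c (⟦ f ⟧ x) ≡ i)

  -- As f is injective, ¬ (x ≈ y) ranges over the pairs of distinct sets in the copy.
  Rainbow : InducedCopy P (𝓑 N) → Set
  Rainbow f = ∀ (x y : Carrier) → ¬ (x ≈ y) → c (⟦ f ⟧ x) ≢ c (⟦ f ⟧ y)

module _ (k : ℕ) (Q P : Poset 0ℓ 0ℓ 0ℓ) where

  Unavoidable : ℕ → Set
  Unavoidable N = ∀ (c : Coloring k N) → Exact c →
    (∃[ f ] Rainbow c Q f) ⊎ (∃[ f ] Monochromatic c P f)

  Good : Set
  Good = ∀ N → N ≥ 1 → Unavoidable N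

  UnavoidableFrom : ℕ → Set
  UnavoidableFrom n = ∀ N → N ≥ 1 → N ≥ n → Unavoidable N

  -- GR_k(Q : P) = n.  The number is only defined for pairs that are not good,
  -- hence the first component.  For such a pair no integer n ≤ 1 satisfies
  -- UnavoidableFrom, so minimising over ℕ is minimising over the integers.
  GR≡ : ℕ → Set
  GR≡ n = ¬ Good × UnavoidableFrom n × (∀ m → UnavoidableFrom m → n ≤ m)

{-# OPTIONS --safe #-}

-- Let c have no rainbow ∨₂.  Sets of two distinct colours other than c ∅ are comparable.
-- If X ⊂ Y ≠ [N] are two such sets, x ∈ X and y ∉ Y, then every set containing y but not x
-- is incomparable to both and so has colour c ∅; with ∅ these sets contain an N-element
-- monochromatic chain.  Two colours besides c ∅ and c [N] (k ≥ 4) provide such X and Y, and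
-- three of them (k ≥ 5) provide X ⊂ Y ⊂ Z ≠ [N], which is contradictory: for z ∉ Z the set
-- X ∪ {z} would have both the colour of Y and that of Z.  For k = 3 fix X of a colour
-- other than c ∅ and c [N], and an N-element chain of proper subsets: either it has a member
-- Y coloured neither c ∅ nor c X, or it uses two colours and the pigeonhole principle applies.

module Submission where

open import Defs
open import Data.Bool using (Bool; true; false; if_then_else_)
open import Data.Empty using (⊥-elim) renaming (⊥ to Absurd)
open import Data.Fin as Fin using (Fin; zero; suc; toℕ; fromℕ; inject≤; punchIn; punchOut)
open import Data.Fin.Induction using (<-weakInduction)
open import Data.Fin.Patterns using (0F; 1F; 2F; 3F)
open import Data.Fin.Permutation
  using (Permutation; Permutation′; _⟨$⟩ʳ_; _⟨$⟩ˡ_; inverseʳ; insert; insert-punchIn)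
  renaming (id to idₚ)
open import Data.Fin.Properties as Finₚ
  using (toℕ-fromℕ; toℕ-inject≤; punchIn-injective; punchInᵢ≢i; punchIn-punchOut; any?)
open import Data.Fin.Subset
open import Data.Fin.Subset.Properties
open import Data.Nat using (ℕ; zero; suc; _+_; _*_; _∸_; _≤_; _<_; _≥_; z≤n; s≤s; _<?_; _≤?_)
open import Data.Nat.Properties as ℕₚ
  using (≤-refl; ≤-reflexive; ≤-trans; <⇒≱; ≮⇒≥; ≰⇒>;
    +-suc; +-identityʳ; m≤m+n; m≤n+m; m<m+n; +-monoʳ-≤; m+n≤o⇒m≤o∸n)
open import Data.Product using (_×_; _,_; proj₁; proj₂; ∃-syntax)
open import Data.Sum using (_⊎_; inj₁; inj₂)
open import Data.Vec using (_∷_; []; here; there; tabulate)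
open import Data.Vec.Properties using (lookup∘tabulate; lookup⇒[]=; []=⇒lookup)
open import Function using (_∘_)
open import Function.Definitions using (Injective)
open import Relation.Binary.Morphism.Structures using (module IsOrderMonomorphism)
open import Relation.Binary.PropositionalEquality
  using (_≡_; _≢_; refl; sym; trans; cong; subst; ≢-sym)
open import Relation.Nullary using (¬_; Dec; yes; no; does; contradiction; ¬?; _×-dec_)
open import Relation.Nullary.Decidable using (dec-true)
open import Relation.Unary using (Pred; Decidable)

private
  variable
    k m n t u N : ℕ

-- Finite subsets: comprehension, strict inclusion, incomparability

module _ {ℓ} {P : Pred (Fin n) ℓ} (P? : Decidable P) where

  comprehension : Subset n
  comprehension = tabulate (does ∘ P?)

  ∈-comprehension⁺ : ∀ {i} → P i → i ∈ comprehension
  ∈-comprehension⁺ {i} p = lookup⇒[]= i _ (trans (lookup∘tabulate _ i) (dec-true (P? i) p))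

  ∈-comprehension⁻ : ∀ {i} → i ∈ comprehension → P i
  ∈-comprehension⁻ {i} i∈ with P? i | trans (sym (lookup∘tabulate (does ∘ P?) i)) ([]=⇒lookup i∈)
  ... | yes p | _ = p

-- `⊂` carries an explicit element of the difference, which a finite search has to produce.
⊆∧≢⇒⊂ : {A B : Subset n} → A ⊆ B → A ≢ B → A ⊂ B
⊆∧≢⇒⊂ {A = A} {B} A⊆B A≢B with any? (λ x → x ∈? B ×-dec ¬? (x ∈? A))
... | yes x∈B∖A = A⊆B , x∈B∖A
... | no  B∖A=∅ = contradiction (⊆-antisym A⊆B B⊆A) A≢B
  where
  B⊆A : B ⊆ A
  B⊆A {x} x∈B with x ∈? A
  ... | yes x∈A = x∈A
  ... | no  x∉A = contradiction (x , x∈B , x∉A) B∖A=∅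

∣p∣≥n⇒p≡⊤ : {A : Subset n} → ∣ A ∣ ≥ n → A ≡ ⊤
∣p∣≥n⇒p≡⊤ {A = A} n≤∣A∣ = ∣p∣≡n⇒p≡⊤ (ℕₚ.≤-antisym (∣p∣≤n A) n≤∣A∣)

s⊆in : {A B : Subset n} {a : Bool} → A ⊆ B → (a ∷ A) ⊆ (inside ∷ B)
s⊆in A⊆B here       = here
s⊆in A⊆B (there x∈) = there (A⊆B x∈)

infix 4 _∥_

_∥_ : Subset n → Subset n → Set
A ∥ B = A ⊈ B × B ⊈ A

separated⇒∥ : ∀ {A B : Subset n} {x y} → x ∈ A → x ∉ B → y ∈ B → y ∉ A → A ∥ B
separated⇒∥ x∈A x∉B y∈B y∉A = (λ A⊆B → x∉B (A⊆B x∈A)) , (λ B⊆A → y∉A (B⊆A y∈B))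

-- Increasing sequences of sets

Increasing : (Fin t → Subset N) → Set
Increasing f = ∀ {i j} → i Fin.< j → f i ⊂ f j

chain-copy : (f : Fin t → Subset N) → Increasing f → InducedCopy (𝓒 t) (𝓑 N)
chain-copy f incr = record
  { ⟦_⟧ = f
  ; isOrderMonomorphism = record
    { isOrderHomomorphism = record { cong = cong f ; mono = mono }
    ; injective = λ fi≡fj → Finₚ.≤-antisym
        (cancel (⊆-reflexive fi≡fj)) (cancel (⊆-reflexive (sym fi≡fj)))
    ; cancel = cancel
    }
  }
  where
  mono : ∀ {i j} → i Fin.≤ j → f i ⊆ f j
  mono {i} {j} i≤j with i Finₚ.≟ j
  ... | yes refl = ⊆-refl
  ... | no  i≢j  = proj₁ (incr (Finₚ.≤∧≢⇒< i≤j i≢j))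

  cancel : ∀ {i j} → f i ⊆ f j → i Fin.≤ j
  cancel {i} {j} fi⊆fj = ≮⇒≥ λ j<i →
    let (_ , _ , x∈fi , x∉fj) = incr j<i in x∉fj (fi⊆fj x∈fi)

HasMonoChain : Coloring k N → ℕ → Set
HasMonoChain c t = ∃[ f ] Monochromatic c (𝓒 t) f

monoChain : ∀ (c : Coloring k N) {a} (f : Fin u → Subset N) → Increasing f →
            (∀ i → c (f i) ≡ a) → t ≤ u → HasMonoChain c t
monoChain {u = u} {t} c f incr cf≡a t≤u =
  chain-copy (λ i → f (inject≤ i t≤u)) (λ i<j → incr (inject≤-mono-< i<j)) ,
  _ , λ i → cf≡a (inject≤ i t≤u)
  where
  inject≤-mono-< : ∀ {i j : Fin t} → i Fin.< j → inject≤ i t≤u Fin.< inject≤ j t≤u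
  inject≤-mono-< {i} {j} i<j
    rewrite toℕ-inject≤ i t≤u | toℕ-inject≤ j t≤u = i<j

-- Each step of a chain adds at least one element. This bounds the monochromatic chains of the
-- extremal colourings.
copy-grows : (f : InducedCopy (𝓒 (suc m)) (𝓑 N)) →
             let open InducedCopy f in m + ∣ ⟦ zero ⟧ ∣ ≤ ∣ ⟦ fromℕ m ⟧ ∣
copy-grows {m} f = subst (λ l → l + ∣ ⟦ zero ⟧ ∣ ≤ ∣ ⟦ fromℕ m ⟧ ∣) (toℕ-fromℕ m) (grows (fromℕ m))
  where
  open InducedCopy f
  open IsOrderMonomorphism isOrderMonomorphism using (mono; injective)

  step : ∀ {i j} → i Fin.< j → ∣ ⟦ i ⟧ ∣ < ∣ ⟦ j ⟧ ∣
  step i<j = p⊂q⇒∣p∣<∣q∣ (⊆∧≢⇒⊂ (mono (ℕₚ.<⇒≤ i<j)) (Finₚ.<⇒≢ i<j ∘ injective))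

  grows : ∀ i → toℕ i + ∣ ⟦ zero ⟧ ∣ ≤ ∣ ⟦ i ⟧ ∣
  grows = <-weakInduction _ ≤-refl λ i ih → ≤-trans
    (s≤s (subst (λ l → l + ∣ ⟦ zero ⟧ ∣ ≤ ∣ ⟦ Fin.inject₁ i ⟧ ∣) (Finₚ.toℕ-inject₁ i) ih))
    (step (s≤s (≤-reflexive (Finₚ.toℕ-inject₁ i))))

-- The maximal chain of a permutation, without its top element [N]

flag : Permutation′ N → Fin N → Subset N
flag π j = comprehension (λ i → (π ⟨$⟩ʳ i) Finₚ.<? j)

module _ (π : Permutation′ N) where

  ∈-flag⁺ : ∀ {i j} → (π ⟨$⟩ʳ i) Fin.< j → i ∈ flag π j
  ∈-flag⁺ {j = j} = ∈-comprehension⁺ (λ i → (π ⟨$⟩ʳ i) Finₚ.<? j)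

  ∈-flag⁻ : ∀ {i j} → i ∈ flag π j → (π ⟨$⟩ʳ i) Fin.< j
  ∈-flag⁻ {j = j} = ∈-comprehension⁻ (λ i → (π ⟨$⟩ʳ i) Finₚ.<? j)

  private
    ∉-flag : ∀ j → (π ⟨$⟩ˡ j) ∉ flag π j
    ∉-flag j j∈ = Finₚ.<-irrefl (inverseʳ π) (∈-flag⁻ j∈)

  flag-increasing : Increasing (flag π)
  flag-increasing {i} {j} i<j =
    (λ x∈ → ∈-flag⁺ (Finₚ.<-trans (∈-flag⁻ x∈) i<j)) ,
    π ⟨$⟩ˡ i , ∈-flag⁺ (subst (Fin._< j) (sym (inverseʳ π)) i<j) , ∉-flag i

  flag≢⊤ : ∀ j → flag π j ≢ ⊤
  flag≢⊤ j eq = ∉-flag j (subst (_ ∈_) (sym eq) ∈⊤)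

insert-at : ∀ (i : Fin (suc m)) (j : Fin (suc n)) (π : Permutation m n) →
            insert i j π ⟨$⟩ʳ i ≡ j
insert-at i j π with i Finₚ.≟ i
... | yes _   = refl
... | no  i≢i = contradiction refl i≢i

-- Two insertions into the identity: the inner one sends the index of `x` among the points other
-- than `y` to the last place, the outer one puts `y` in front and shifts the rest by one.
permutation-to-ends : ∀ {x y : Fin (2 + n)} → y ≢ x →
  ∃[ π ] π ⟨$⟩ʳ y ≡ zero × π ⟨$⟩ʳ x ≡ fromℕ (suc n)
permutation-to-ends {n} {x} {y} y≢x =
  insert y zero π , insert-at y zero π ,
  trans (cong (insert y zero π ⟨$⟩ʳ_) (sym (punchIn-punchOut y≢x)))
    (trans (insert-punchIn y zero π (punchOut y≢x))
      (cong suc (insert-at (punchOut y≢x) (fromℕ n) idₚ)))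
  where
  π = insert (punchOut y≢x) (fromℕ n) idₚ

-- Colourings without a rainbow ∨₂

NoRainbow : Coloring k N → Set
NoRainbow c = ∀ {A B C} → A ⊆ B → A ⊆ C → B ∥ C → c A ≢ c B → c A ≢ c C → c B ≡ c C

rainbow-copy : ∀ {c : Coloring k N} {A B C} → A ⊆ B → A ⊆ C → B ∥ C →
               c A ≢ c B → c A ≢ c C → c B ≢ c C → ∃[ f ] Rainbow c ∨₂ f
rainbow-copy {k} {N} {c} {A} {B} {C} A⊆B A⊆C (B⊈C , C⊈B) cA≢cB cA≢cC cB≢cC =
  record
    { ⟦_⟧ = f
    ; isOrderMonomorphism = record
      { isOrderHomomorphism = record { cong = cong f ; mono = mono }
      ; injective = λ {x} {y} → injective x y
      ; cancel = λ {x} {y} → cancel x y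
      }
    } , rainbow
  where
  f : V → Subset N
  f X₀ = A
  f X₁ = B
  f X₂ = C

  mono : ∀ {x y} → x ≤V y → f x ⊆ f y
  mono ≤V-refl = ⊆-refl
  mono X₀≤X₁   = A⊆B
  mono X₀≤X₂   = A⊆C

  cancel : ∀ x y → f x ⊆ f y → x ≤V y
  cancel X₀ X₀ _ = ≤V-refl
  cancel X₀ X₁ _ = X₀≤X₁
  cancel X₀ X₂ _ = X₀≤X₂
  cancel X₁ X₀ B⊆A = contradiction (λ {_} → ⊆-trans B⊆A A⊆C) B⊈C
  cancel X₁ X₁ _ = ≤V-refl
  cancel X₁ X₂ B⊆C = contradiction (λ {_} → B⊆C) B⊈C
  cancel X₂ X₀ C⊆A = contradiction (λ {_} → ⊆-trans C⊆A A⊆B) C⊈B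
  cancel X₂ X₁ C⊆B = contradiction (λ {_} → C⊆B) C⊈B
  cancel X₂ X₂ _ = ≤V-refl

  rainbow : ∀ x y → x ≢ y → c (f x) ≢ c (f y)
  rainbow X₀ X₀ x≢y = contradiction refl x≢y
  rainbow X₀ X₁ _   = cA≢cB
  rainbow X₀ X₂ _   = cA≢cC
  rainbow X₁ X₀ _   = ≢-sym cA≢cB
  rainbow X₁ X₁ x≢y = contradiction refl x≢y
  rainbow X₁ X₂ _   = cB≢cC
  rainbow X₂ X₀ _   = ≢-sym cA≢cC
  rainbow X₂ X₁ _   = ≢-sym cB≢cC
  rainbow X₂ X₂ x≢y = contradiction refl x≢y

  _≟V_ : (x y : V) → Dec (x ≡ y)
  X₀ ≟V X₀ = yes refl
  X₀ ≟V X₁ = no λ ()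
  X₀ ≟V X₂ = no λ ()
  X₁ ≟V X₀ = no λ ()
  X₁ ≟V X₁ = yes refl
  X₁ ≟V X₂ = no λ ()
  X₂ ≟V X₀ = no λ ()
  X₂ ≟V X₁ = no λ ()
  X₂ ≟V X₂ = yes refl

  injective : ∀ x y → f x ≡ f y → x ≡ y
  injective x y fx≡fy with x ≟V y
  ... | yes x≡y = x≡y
  ... | no  x≢y = contradiction (cong c fx≡fy) (rainbow x y x≢y)

-- There are finitely many triples of subsets, so an exhaustive search settles the dichotomy
-- constructively.
rainbow? : (c : Coloring k N) → (∃[ f ] Rainbow c ∨₂ f) ⊎ NoRainbow c
rainbow? c with (anySubset? λ A → anySubset? λ B → anySubset? λ C →
  A ⊆? B ×-dec A ⊆? C ×-dec (¬? (B ⊆? C) ×-dec ¬? (C ⊆? B)) ×-dec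
  ¬? (c A Finₚ.≟ c B) ×-dec ¬? (c A Finₚ.≟ c C) ×-dec ¬? (c B Finₚ.≟ c C))
... | yes (_ , _ , _ , A⊆B , A⊆C , B∥C , cA≢cB , cA≢cC , cB≢cC) =
  inj₁ (rainbow-copy A⊆B A⊆C B∥C cA≢cB cA≢cC cB≢cC)
... | no none = inj₂ noRainbow
  where
  noRainbow : NoRainbow c
  noRainbow {A} {B} {C} A⊆B A⊆C B∥C cA≢cB cA≢cC with c B Finₚ.≟ c C
  ... | yes cB≡cC = cB≡cC
  ... | no  cB≢cC = ⊥-elim (none (A , B , C , A⊆B , A⊆C , B∥C , cA≢cB , cA≢cC , cB≢cC))

noRainbow⇒¬rainbow : ∀ {c : Coloring k N} → NoRainbow c → ¬ (∃[ f ] Rainbow c ∨₂ f)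
noRainbow⇒¬rainbow nr (f , rainbow) = rainbow X₁ X₂ (λ ())
  (nr (mono X₀≤X₁) (mono X₀≤X₂) ((λ B⊆C → ≰₁₂ (cancel B⊆C)) , (λ C⊆B → ≰₂₁ (cancel C⊆B)))
    (rainbow X₀ X₁ (λ ())) (rainbow X₀ X₂ (λ ())))
  where
  open IsOrderMonomorphism (InducedCopy.isOrderMonomorphism f) using (mono; cancel)

  ≰₁₂ : ¬ X₁ ≤V X₂
  ≰₁₂ ()

  ≰₂₁ : ¬ X₂ ≤V X₁
  ≰₂₁ ()

module _ {c : Coloring k N} (nr : NoRainbow c) where

  -- Otherwise ∅ below `B` and `C` would complete a rainbow copy.
  comparable : ∀ {B C} → c ⊥ ≢ c B → c ⊥ ≢ c C → c B ≢ c C → B ⊆ C ⊎ C ⊆ B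
  comparable {B} {C} c⊥≢cB c⊥≢cC cB≢cC with B ⊆? C | C ⊆? B
  ... | yes B⊆C | _       = inj₁ B⊆C
  ... | no  _   | yes C⊆B = inj₂ C⊆B
  ... | no  B⊈C | no  C⊈B = contradiction (nr ⊥⊆ ⊥⊆ (B⊈C , C⊈B) c⊥≢cB c⊥≢cC) cB≢cC

  -- With any other colour on `W`, the copies with bottom ∅ would force it to equal both `c X` and
  -- `c Y`.
  ∥-both⇒c⊥ : ∀ {W X Y} → W ∥ X → W ∥ Y → c ⊥ ≢ c X → c ⊥ ≢ c Y → c X ≢ c Y → c W ≡ c ⊥
  ∥-both⇒c⊥ {W} W∥X W∥Y c⊥≢cX c⊥≢cY cX≢cY with c ⊥ Finₚ.≟ c W
  ... | yes c⊥≡cW = sym c⊥≡cW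
  ... | no  c⊥≢cW = contradiction
    (trans (sym (nr ⊥⊆ ⊥⊆ W∥X c⊥≢cW c⊥≢cX)) (nr ⊥⊆ ⊥⊆ W∥Y c⊥≢cW c⊥≢cY)) cX≢cY

  -- The bottom of the copy on `U` and `Y` depends on `c U`: it is `X` if `U` is coloured like ∅,
  -- and ∅ itself otherwise.
  above-∥ : ∀ {X Y U} → X ⊆ Y → X ⊆ U → U ∥ Y →
            c ⊥ ≢ c X → c ⊥ ≢ c Y → c X ≢ c Y → c U ≡ c Y
  above-∥ {U = U} X⊆Y X⊆U U∥Y c⊥≢cX c⊥≢cY cX≢cY with c ⊥ Finₚ.≟ c U
  ... | yes c⊥≡cU = nr X⊆U X⊆Y U∥Y (λ cX≡cU → c⊥≢cX (trans c⊥≡cU (sym cX≡cU))) cX≢cY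
  ... | no  c⊥≢cU = nr ⊥⊆ ⊥⊆ U∥Y c⊥≢cU c⊥≢cY

  longChain-⊂ : ∀ {X Y} → X ⊂ Y → Y ≢ ⊤ → c ⊥ ≢ c X → c ⊥ ≢ c Y → c X ≢ c Y →
                t ≤ N → HasMonoChain c t
  longChain-⊂ {t = t} {X} {Y} (X⊆Y , _) Y≢⊤ c⊥≢cX c⊥≢cY cX≢cY =
    chain (⊆∧≢⇒⊂ ⊥⊆ (c⊥≢cX ∘ cong c)) (⊆∧≢⇒⊂ ⊆⊤ Y≢⊤)
    where
    colour⊥ : ∀ {x y W} → x ∈ X → y ∉ Y → y ∈ W → x ∉ W → c W ≡ c ⊥
    colour⊥ x∈X y∉Y y∈W x∉W = ∥-both⇒c⊥
      (separated⇒∥ y∈W (λ y∈X → y∉Y (X⊆Y y∈X)) x∈X x∉W)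
      (separated⇒∥ y∈W y∉Y (X⊆Y x∈X) x∉W)
      c⊥≢cX c⊥≢cY cX≢cY

    flag-colour : ∀ {n} (c : Coloring k (2 + n)) {x y} (π : Permutation′ (2 + n)) →
      π ⟨$⟩ʳ y ≡ zero → π ⟨$⟩ʳ x ≡ fromℕ (suc n) →
      (∀ {W} → y ∈ W → x ∉ W → c W ≡ c ⊥) → ∀ j → c (flag π j) ≡ c ⊥
    flag-colour c π πy≡0 πx≡max _ zero =
      cong c (Empty-unique λ (_ , i∈) → ℕₚ.n≮0 (∈-flag⁻ π {j = zero} i∈))
    -- `y` enters first and `x` has the last position, so every flag set after the empty one
    -- contains `y` and misses `x`.
    flag-colour c π πy≡0 πx≡max colour (suc j) = colour
      (∈-flag⁺ π (subst (Fin._< suc j) (sym πy≡0) (s≤s z≤n)))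
      (λ x∈ → <⇒≱ (subst (Fin._< suc j) πx≡max (∈-flag⁻ π x∈)) (Finₚ.≤fromℕ (suc j)))

    chain : ⊥ ⊂ X → Y ⊂ ⊤ → t ≤ N → HasMonoChain c t
    chain (_ , x , x∈X , _) (_ , y , _ , y∉Y) = build N c x y y≢x (colour⊥ x∈X y∉Y)
      where
      y≢x : y ≢ x
      y≢x refl = y∉Y (X⊆Y x∈X)

      -- The ambient `N` is fixed here, so it is generalised to allow a case split; two distinct
      -- points force `N` to be at least 2.
      build : ∀ N (c : Coloring k N) (x y : Fin N) → y ≢ x →
              (∀ {W} → y ∈ W → x ∉ W → c W ≡ c ⊥) → t ≤ N → HasMonoChain c t
      build 1 _ zero zero y≢x _ = contradiction refl y≢x
      build (suc (suc n)) c x y y≢x colour =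
        let (π , πy≡0 , πx≡max) = permutation-to-ends y≢x
        in monoChain c (flag π) (flag-increasing π) (flag-colour c π πy≡0 πx≡max colour)

  longChain : ∀ {X Y} → X ≢ ⊤ → Y ≢ ⊤ → c ⊥ ≢ c X → c ⊥ ≢ c Y → c X ≢ c Y →
              t ≤ N → HasMonoChain c t
  longChain X≢⊤ Y≢⊤ c⊥≢cX c⊥≢cY cX≢cY with comparable c⊥≢cX c⊥≢cY cX≢cY
  ... | inj₁ X⊆Y = longChain-⊂ (⊆∧≢⇒⊂ X⊆Y (cX≢cY ∘ cong c)) Y≢⊤ c⊥≢cX c⊥≢cY cX≢cY
  ... | inj₂ Y⊆X = longChain-⊂ (⊆∧≢⇒⊂ Y⊆X (cX≢cY ∘ sym ∘ cong c)) X≢⊤ c⊥≢cY c⊥≢cX (≢-sym cX≢cY)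

-- Proper sets of distinct colours

record ProperFamily (c : Coloring k N) (m : ℕ) : Set where
  field
    member   : Fin m → Subset N
    proper   : ∀ i → member i ≢ ⊤
    colour≢⊥ : ∀ i → c ⊥ ≢ c (member i)
    distinct : ∀ {i j} → i ≢ j → c (member i) ≢ c (member j)

avoid₂ : (a b : Fin (2 + m)) →
  ∃[ e ] Injective _≡_ _≡_ e × (∀ (i : Fin m) → a ≢ e i × b ≢ e i)
avoid₂ {m} a b with a Finₚ.≟ b
-- If both colours coincide, `punchIn a` skips only one; `suc` drops a further colour so that
-- exactly `m` remain.
... | yes refl = punchIn a ∘ suc , Finₚ.suc-injective ∘ punchIn-injective a _ _ ,
  λ i → ≢-sym (punchInᵢ≢i a (suc i)) , ≢-sym (punchInᵢ≢i a (suc i))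
... | no a≢b = punchIn a ∘ punchIn b′ ,
  (λ eq → punchIn-injective b′ _ _ (punchIn-injective a _ _ eq)) ,
  λ i → ≢-sym (punchInᵢ≢i a (punchIn b′ i)) ,
    λ b≡ → punchInᵢ≢i b′ i (sym (punchIn-injective a _ _ (trans (punchIn-punchOut a≢b) b≡)))
  where
  b′ = punchOut a≢b

-- Choose one set for each of `m` colours other than those of ∅ and [N]; avoiding the colour of [N]
-- is what makes the sets proper.
exact⇒properFamily : ∀ {c : Coloring (2 + m) N} → Exact c → ProperFamily c m
exact⇒properFamily {c = c} exact = record
  { member   = λ i → proj₁ (exact (e i))
  ; proper   = λ i A≡⊤ → proj₂ (e-avoids i) (trans (sym (cong c A≡⊤)) (proj₂ (exact (e i))))
  ; colour≢⊥ = λ i c⊥≡ → proj₁ (e-avoids i) (trans c⊥≡ (proj₂ (exact (e i))))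
  ; distinct = λ {i} {j} i≢j eq → i≢j (e-injective
      (trans (sym (proj₂ (exact (e i)))) (trans eq (proj₂ (exact (e j))))))
  }
  where
  e-all = avoid₂ (c ⊥) (c ⊤)
  e = proj₁ e-all
  e-injective = proj₁ (proj₂ e-all)
  e-avoids = proj₂ (proj₂ e-all)

module _ {c : Coloring k N} (nr : NoRainbow c) (F : ProperFamily c m) where
  open ProperFamily F

  member-⊂ : ∀ {i j} → i ≢ j → member i ⊆ member j → member i ⊂ member j
  member-⊂ i≢j A⊆B = ⊆∧≢⇒⊂ A⊆B (distinct i≢j ∘ cong c)

  member-comparable : ∀ {i j} → i ≢ j → member i ⊆ member j ⊎ member j ⊆ member i
  member-comparable {i} {j} i≢j = comparable nr (colour≢⊥ i) (colour≢⊥ j) (distinct i≢j)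

  familyChain : ∀ {i j} → i ≢ j → t ≤ N → HasMonoChain c t
  familyChain {i = i} {j} i≢j =
    longChain nr (proper i) (proper j) (colour≢⊥ i) (colour≢⊥ j) (distinct i≢j)

  -- The sizes increase strictly along ∅ ⊂ X ⊂ Y ⊂ [N].
  nested₂⇒3≤N : ∀ {i j} → i ≢ j → member i ⊆ member j → 3 ≤ N
  nested₂⇒3≤N {i} {j} i≢j X⊆Y = begin
    3                    ≤⟨ s≤s (s≤s (≤-trans (s≤s z≤n) (p⊂q⇒∣p∣<∣q∣ ⊥⊂X))) ⟩
    2 + ∣ member i ∣     ≤⟨ s≤s (p⊂q⇒∣p∣<∣q∣ (member-⊂ i≢j X⊆Y)) ⟩
    1 + ∣ member j ∣     ≤⟨ p⊂q⇒∣p∣<∣q∣ (⊆∧≢⇒⊂ ⊆⊤ (proper j)) ⟩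
    ∣ ⊤ {N} ∣            ≡⟨ ∣⊤∣≡n N ⟩
    N                    ∎
    where
    open ℕₚ.≤-Reasoning
    ⊥⊂X : ⊥ ⊂ member i
    ⊥⊂X = ⊆∧≢⇒⊂ ⊥⊆ (colour≢⊥ i ∘ cong c)

  3≤N : ∀ {i j} → i ≢ j → 3 ≤ N
  3≤N i≢j with member-comparable i≢j
  ... | inj₁ X⊆Y = nested₂⇒3≤N i≢j X⊆Y
  ... | inj₂ Y⊆X = nested₂⇒3≤N (≢-sym i≢j) Y⊆X

  -- The set `U` contains X and is incomparable to Y and to Z: each of them misses `z` and has an
  -- element outside X, which is not `z`. Hence `above-∥` applies to both.
  ¬nested₃ : ∀ {i j l} → i ≢ j → i ≢ l → j ≢ l →
             member i ⊆ member j → member j ⊆ member l → Absurd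
  ¬nested₃ {i} {j} {l} i≢j i≢l j≢l X⊆Y Y⊆Z with ⊆∧≢⇒⊂ ⊆⊤ (proper l)
  ... | _ , z , _ , z∉Z = distinct j≢l (trans
    (sym (colourU X⊆Y (λ z∈Y → z∉Z (Y⊆Z z∈Y)) i≢j))
    (colourU (λ x∈X → Y⊆Z (X⊆Y x∈X)) z∉Z i≢l))
    where
    X = member i
    U = X ∪ ⁅ z ⁆

    colourU : ∀ {j} → X ⊆ member j → z ∉ member j → i ≢ j → c U ≡ c (member j)
    colourU {j} X⊆Y z∉Y i≢j with member-⊂ i≢j X⊆Y
    ... | _ , y , y∈Y , y∉X = above-∥ nr X⊆Y (p⊆p∪q ⁅ z ⁆)
      (separated⇒∥ (q⊆p∪q X ⁅ z ⁆ (x∈⁅x⁆ z)) z∉Y y∈Y y∉U)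
      (colour≢⊥ i) (colour≢⊥ j) (distinct i≢j)
      where
      y∉U : y ∉ U
      y∉U y∈U with x∈p∪q⁻ X ⁅ z ⁆ y∈U
      ... | inj₁ y∈X = y∉X y∈X
      ... | inj₂ y∈z = z∉Y (subst (_∈ member j) (x∈⁅y⁆⇒x≡y z y∈z) y∈Y)

  -- The third member is comparable to both others, so it fits above, between or below the nested
  -- pair.
  ¬nested₂ : ∀ {i j l} → i ≢ j → i ≢ l → j ≢ l → member i ⊆ member j → Absurd
  ¬nested₂ i≢j i≢l j≢l X⊆Y with member-comparable j≢l
  ... | inj₁ Y⊆Z = ¬nested₃ i≢j i≢l j≢l X⊆Y Y⊆Z
  ... | inj₂ Z⊆Y with member-comparable i≢l
  ...   | inj₁ X⊆Z = ¬nested₃ i≢l i≢j (≢-sym j≢l) X⊆Z Z⊆Y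
  ...   | inj₂ Z⊆X = ¬nested₃ (≢-sym i≢l) (≢-sym j≢l) i≢j Z⊆X X⊆Y

  ¬three : ∀ {i j l} → i ≢ j → i ≢ l → j ≢ l → Absurd
  ¬three i≢j i≢l j≢l with member-comparable i≢j
  ... | inj₁ X⊆Y = ¬nested₂ i≢j i≢l j≢l X⊆Y
  ... | inj₂ Y⊆X = ¬nested₂ (≢-sym i≢j) j≢l i≢l Y⊆X

-- Pigeonhole principle along a chain

-- Composing an increasing sequence with this enumeration extracts the subchain indexed by `S`, such
-- as a colour class.
enumerate : (S : Subset n) →
  ∃[ e ] (∀ (i : Fin ∣ S ∣) → e i ∈ S) × (∀ {i j} → i Fin.< j → e i Fin.< e j)
enumerate [] = (λ ()) , (λ ()) , λ { {()} }
enumerate (outside ∷ S) with enumerate S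
... | e , e∈ , e-mono = suc ∘ e , there ∘ e∈ , s≤s ∘ e-mono
enumerate (inside ∷ S) with enumerate S
... | e , e∈ , e-mono = e′ , e′∈ , e′-mono
  where
  e′ : Fin (suc ∣ S ∣) → Fin _
  e′ zero    = zero
  e′ (suc i) = suc (e i)

  e′∈ : ∀ i → e′ i ∈ inside ∷ S
  e′∈ zero    = here
  e′∈ (suc i) = there (e∈ i)

  e′-mono : ∀ {i j} → i Fin.< j → e′ i Fin.< e′ j
  e′-mono {zero}  {suc j} _         = s≤s z≤n
  e′-mono {suc i} {suc j} (s≤s i<j) = s≤s (e-mono i<j)

module _ (c : Coloring k N) {a b : Fin k} (f : Fin n → Subset N) (incr : Increasing f)
         (a-or-b : ∀ i → c (f i) ≡ a ⊎ c (f i) ≡ b) where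

  private
    a? : Decidable (λ i → c (f i) ≡ a)
    a? i = c (f i) Finₚ.≟ a

    S : Subset n
    S = comprehension a?

    ∈∁S⇒b : ∀ {i} → i ∈ ∁ S → c (f i) ≡ b
    ∈∁S⇒b {i} i∈∁S with a-or-b i
    ... | inj₁ ≡a = contradiction (∈-comprehension⁺ a? ≡a) (x∈∁p⇒x∉p i∈∁S)
    ... | inj₂ ≡b = ≡b

  -- If colour `a` occurs at most `t` times, its complement has at least `n ∸ t`, hence more than
  -- `t`, indices.
  pigeonholeChain : t + suc t ≤ n → HasMonoChain c (suc t)
  pigeonholeChain {t} 2t<n with suc t ≤? ∣ S ∣
  ... | yes t<∣S∣ =
    let (e , e∈S , e-mono) = enumerate S
    in monoChain c (f ∘ e) (incr ∘ e-mono) (λ i → ∈-comprehension⁻ a? (e∈S i)) t<∣S∣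
  ... | no t≮∣S∣ =
    let (e , e∈∁S , e-mono) = enumerate (∁ S)
    in monoChain c (f ∘ e) (incr ∘ e-mono) (λ i → ∈∁S⇒b (e∈∁S i)) t<∣∁S∣
    where
    t<∣∁S∣ : suc t ≤ ∣ ∁ S ∣
    t<∣∁S∣ = subst (suc t ≤_) (sym (∣∁p∣≡n∸∣p∣ S)) (m+n≤o⇒m≤o∸n (suc t)
      (≤-trans (+-monoʳ-≤ (suc t) (ℕₚ.≤-pred (≰⇒> t≮∣S∣)))
        (subst (_≤ n) (+-suc t t) 2t<n)))

twoColourChain : ∀ {c : Coloring k N} → NoRainbow c → ProperFamily c 1 →
                 t + suc t ≤ N → HasMonoChain c (suc t)
twoColourChain {N = N} {t} {c = c} nr F 2t<N
  with any? (λ j → ¬? (c ⊥ Finₚ.≟ c (flag idₚ j)) ×-dec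
                   ¬? (c (ProperFamily.member F 0F) Finₚ.≟ c (flag idₚ j)))
-- The flag omits [N], so a third colour on it belongs to a proper set, as `longChain` requires.
... | yes (j , c⊥≢ , cX≢) = longChain nr (proper 0F) (flag≢⊤ idₚ j) (colour≢⊥ 0F) c⊥≢ cX≢
  (≤-trans (m≤n+m (suc t) t) 2t<N)
  where open ProperFamily F
... | no none = pigeonholeChain c (flag idₚ) (flag-increasing idₚ) two 2t<N
  where
  open ProperFamily F
  two : ∀ j → c (flag idₚ j) ≡ c ⊥ ⊎ c (flag idₚ j) ≡ c (member 0F)
  two j with c ⊥ Finₚ.≟ c (flag idₚ j) | c (member 0F) Finₚ.≟ c (flag idₚ j)
  ... | yes eq | _      = inj₁ (sym eq)
  ... | no _   | yes eq = inj₂ (sym eq)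
  ... | no c⊥≢ | no cX≢ = contradiction (j , c⊥≢ , cX≢) none

-- Colourings avoiding both configurations

avoiding : (c : Coloring k N) → Exact c → NoRainbow c → ¬ HasMonoChain c t →
           ¬ Unavoidable k ∨₂ (𝓒 t) N
avoiding c exact nr ¬mono unavoidable with unavoidable c exact
... | inj₁ rainbow = noRainbow⇒¬rainbow nr rainbow
... | inj₂ mono    = ¬mono mono

-- For N = 2a each of the three classes meets a chain in at most a sets.
sizeColour : ℕ → (N : ℕ) → Coloring 3 N
sizeColour a N A with ∣ A ∣ <? a | ∣ A ∣ <? N
... | yes _ | _     = 0F
... | no  _ | yes _ = 1F
... | no  _ | no  _ = 2F

module _ {a : ℕ} where

  size<a : ∀ (A : Subset N) → sizeColour a N A ≡ 0F → ∣ A ∣ < a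
  size<a {N} A eq with ∣ A ∣ <? a | ∣ A ∣ <? N
  ... | yes <a | _ = <a
  size<a A () | no _ | yes _
  size<a A () | no _ | no _

  a≤size<N : ∀ (A : Subset N) → sizeColour a N A ≡ 1F → a ≤ ∣ A ∣ × ∣ A ∣ < N
  a≤size<N {N} A eq with ∣ A ∣ <? a | ∣ A ∣ <? N
  a≤size<N A () | yes _ | _
  ... | no ≮a | yes <N = ≮⇒≥ ≮a , <N
  a≤size<N A () | no _ | no _

  size≥N : ∀ (A : Subset N) → sizeColour a N A ≡ 2F → ∣ A ∣ ≥ N
  size≥N {N} A eq with ∣ A ∣ <? a | ∣ A ∣ <? N
  size≥N A () | yes _ | _
  size≥N A () | no _ | yes _
  ... | no _ | no ≮N = ≮⇒≥ ≮N

  sizeColour-0 : ∀ (A : Subset N) → ∣ A ∣ < a → sizeColour a N A ≡ 0F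
  sizeColour-0 {N} A <a with ∣ A ∣ <? a | ∣ A ∣ <? N
  ... | yes _ | _ = refl
  ... | no ≮a | _ = contradiction <a ≮a

  sizeColour-1 : ∀ (A : Subset N) → a ≤ ∣ A ∣ → ∣ A ∣ < N → sizeColour a N A ≡ 1F
  sizeColour-1 {N} A ≥a <N with ∣ A ∣ <? a | ∣ A ∣ <? N
  ... | yes <a | _      = contradiction ≥a (<⇒≱ <a)
  ... | no _   | yes _  = refl
  ... | no _   | no ≮N  = contradiction <N ≮N

  sizeColour-2 : ∀ (A : Subset N) → a ≤ ∣ A ∣ → N ≤ ∣ A ∣ → sizeColour a N A ≡ 2F
  sizeColour-2 {N} A ≥a ≥N with ∣ A ∣ <? a | ∣ A ∣ <? N
  ... | yes <a | _      = contradiction ≥a (<⇒≱ <a)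
  ... | no _   | yes <N = contradiction ≥N (<⇒≱ <N)
  ... | no _   | no _   = refl

  sizeColour-exact : 0 < a → a ≤ N → Exact (sizeColour a (suc N))
  sizeColour-exact {N} 0<a a≤N 0F =
    ⊥ , sizeColour-0 ⊥ (subst (_< a) (sym (∣⊥∣≡0 (suc N))) 0<a)
  -- The ground set has `suc N` points; a set missing just one of them has size `N`, which lies in
  -- the middle class.
  sizeColour-exact {N} 0<a a≤N 1F = outside ∷ ⊤ , sizeColour-1 (outside ∷ ⊤)
    (subst (a ≤_) (sym (∣⊤∣≡n N)) a≤N) (s≤s (≤-reflexive (∣⊤∣≡n N)))
  sizeColour-exact {N} 0<a a≤N 2F = ⊤ , sizeColour-2 ⊤
    (subst (a ≤_) (sym (∣⊤∣≡n (suc N))) (ℕₚ.m≤n⇒m≤1+n a≤N)) (≤-reflexive (sym (∣⊤∣≡n (suc N))))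

  -- Only [N] has colour 2, and neither two incomparable sets nor a set below them can be [N]. Three
  -- sets thus share two colours.
  sizeColour-noRainbow : NoRainbow (sizeColour a N)
  sizeColour-noRainbow {N} {A} {B} {C} A⊆B A⊆C (B⊈C , C⊈B) = two-colours _ _ _
    (λ cA≡2 → B≢⊤ (⊆-antisym ⊆⊤ (subst (_⊆ B) (∣p∣≥n⇒p≡⊤ (size≥N A cA≡2)) A⊆B)))
    (B≢⊤ ∘ ∣p∣≥n⇒p≡⊤ ∘ size≥N B)
    (C≢⊤ ∘ ∣p∣≥n⇒p≡⊤ ∘ size≥N C)
    where
    B≢⊤ : B ≢ ⊤
    B≢⊤ refl = C⊈B ⊆⊤

    C≢⊤ : C ≢ ⊤
    C≢⊤ refl = B⊈C ⊆⊤

    two-colours : (x y z : Fin 3) → x ≢ 2F → y ≢ 2F → z ≢ 2F → x ≢ y → x ≢ z → y ≡ z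
    two-colours 2F _  _  x≢2 _   _   _   _   = contradiction refl x≢2
    two-colours _  2F _  _   y≢2 _   _   _   = contradiction refl y≢2
    two-colours _  _  2F _   _   z≢2 _   _   = contradiction refl z≢2
    two-colours 0F 0F _  _   _   _   x≢y _   = contradiction refl x≢y
    two-colours 1F 1F _  _   _   _   x≢y _   = contradiction refl x≢y
    two-colours 0F _  0F _   _   _   _   x≢z = contradiction refl x≢z
    two-colours 1F _  1F _   _   _   _   x≢z = contradiction refl x≢z
    two-colours 0F 1F 1F _   _   _   _   _   = refl
    two-colours 1F 0F 0F _   _   _   _   _   = refl

  -- A chain of `suc a` sets gains at least `a` elements from bottom to top, but the sizes within a
  -- class lie below `a`, in the interval from `a` to `N ∸ 1`, or at `N` alone.
  sizeColour-noMonoChain : 0 < a → N ≤ a + a → ¬ HasMonoChain (sizeColour a N) (suc a)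
  sizeColour-noMonoChain {N} 0<a N≤2a (f , colour , cf≡) = absurd colour cf≡
    where
    open InducedCopy f
    bottom = ⟦ zero ⟧
    top    = ⟦ fromℕ a ⟧

    absurd : ∀ i → (∀ x → sizeColour a N (⟦ x ⟧) ≡ i) → Absurd
    absurd 0F cf≡ = <⇒≱ (size<a top (cf≡ _)) (≤-trans (m≤m+n a _) (copy-grows f))
    absurd 1F cf≡ = <⇒≱ (proj₂ (a≤size<N top (cf≡ _)))
      (≤-trans N≤2a (≤-trans (+-monoʳ-≤ a (proj₁ (a≤size<N bottom (cf≡ _)))) (copy-grows f)))
    absurd 2F cf≡ = <⇒≱ (≤-trans (ℕₚ.+-mono-≤ 0<a (size≥N bottom (cf≡ _))) (copy-grows f))
      (∣p∣≤n top)

-- Interval colouring: for Z = [N] minus two points, Z and [N] get the colours 1 and 3, the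
-- sets strictly between them 2, and all other sets 0.

intervalTop : Bool → Bool → Fin 4
intervalTop false false = 1F
intervalTop false true  = 2F
intervalTop true  false = 2F
intervalTop true  true  = 3F

intervalColour : Coloring 4 (2 + n)
intervalColour (a ∷ b ∷ A) = if does (⊤ ⊆? A) then intervalTop a b else 0F

module _ (a b : Bool) (A : Subset n) where

  intervalColour-top : ⊤ ⊆ A → intervalColour (a ∷ b ∷ A) ≡ intervalTop a b
  intervalColour-top ⊤⊆A rewrite dec-true (⊤ ⊆? A) ⊤⊆A = refl

  coloured⇒⊤⊆ : intervalColour (a ∷ b ∷ A) ≢ 0F → ⊤ ⊆ A
  coloured⇒⊤⊆ c≢0 with ⊤ ⊆? A
  ... | yes ⊤⊆A = ⊤⊆A
  ... | no  _   = contradiction refl c≢0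

-- The index `suc n` makes Z nonempty, so that ∅ lies outside the interval and has colour 0.
intervalColour-exact : Exact (intervalColour {suc n})
intervalColour-exact 0F = ⊥ , refl
intervalColour-exact {n} 1F = false ∷ false ∷ ⊤ , intervalColour-top false false (⊤ {1 + n}) ⊆⊤
intervalColour-exact {n} 2F = false ∷ true ∷ ⊤ , intervalColour-top false true (⊤ {1 + n}) ⊆⊤
intervalColour-exact {n} 3F = true ∷ true ∷ ⊤ , intervalColour-top true true (⊤ {1 + n}) ⊆⊤

-- The tails agree, so incomparability is decided by the first two coordinates. There only the two
-- singletons are incomparable, and both get colour 2.
∥⇒intervalTop≡ : ∀ a b a′ b′ {A B : Subset n} → A ⊆ B → B ⊆ A →
  (a ∷ b ∷ A) ∥ (a′ ∷ b′ ∷ B) → intervalTop a b ≡ intervalTop a′ b′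
∥⇒intervalTop≡ false false _ _ A⊆B _ (≰ , _) = ⊥-elim (≰ (out⊆ (out⊆ A⊆B)))
∥⇒intervalTop≡ true  true  _ _ _ B⊆A (_ , ≰) = ⊥-elim (≰ (s⊆in (s⊆in B⊆A)))
∥⇒intervalTop≡ _ _ false false _ B⊆A (_ , ≰) = ⊥-elim (≰ (out⊆ (out⊆ B⊆A)))
∥⇒intervalTop≡ _ _ true  true  A⊆B _ (≰ , _) = ⊥-elim (≰ (s⊆in (s⊆in A⊆B)))
∥⇒intervalTop≡ false true  false true  _ _ _ = refl
∥⇒intervalTop≡ false true  true  false _ _ _ = refl
∥⇒intervalTop≡ true  false false true  _ _ _ = refl
∥⇒intervalTop≡ true  false true  false _ _ _ = refl

-- Nonzero colours occur only above Z. If `A` has colour 0, then `B` and `C` are coloured nonzero;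
-- if not, they contain `A` and with it Z. Either way both lie in the interval.
intervalColour-noRainbow : NoRainbow (intervalColour {n})
intervalColour-noRainbow {A = a ∷ a′ ∷ A} {b ∷ b′ ∷ B} {d ∷ d′ ∷ C} A⊆B A⊆C B∥C cA≢cB cA≢cC =
  trans (intervalColour-top b b′ B (proj₁ ⊤⊆B,C))
    (trans (∥⇒intervalTop≡ b b′ d d′
        (⊆-trans ⊆⊤ (proj₂ ⊤⊆B,C)) (⊆-trans ⊆⊤ (proj₁ ⊤⊆B,C)) B∥C)
      (sym (intervalColour-top d d′ C (proj₂ ⊤⊆B,C))))
  where
  ⊤⊆B,C : ⊤ ⊆ B × ⊤ ⊆ C
  ⊤⊆B,C with intervalColour (a ∷ a′ ∷ A) Finₚ.≟ 0F
  ... | yes cA≡0 =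
    coloured⇒⊤⊆ b b′ B (λ cB≡0 → cA≢cB (trans cA≡0 (sym cB≡0))) ,
    coloured⇒⊤⊆ d d′ C (λ cC≡0 → cA≢cC (trans cA≡0 (sym cC≡0)))
  ... | no cA≢0 = let ⊤⊆A = λ {x} → coloured⇒⊤⊆ a a′ A cA≢0 {x} in
    ⊆-trans ⊤⊆A (drop-∷-⊆ (drop-∷-⊆ A⊆B)) , ⊆-trans ⊤⊆A (drop-∷-⊆ (drop-∷-⊆ A⊆C))

-- On `3 + n` points a chain of `4 + n` sets must run from ∅ to [N]; but [N] has colour 3, and sets
-- of nonzero colour contain the nonempty Z.
intervalColour-noMonoChain : ¬ HasMonoChain (intervalColour {suc n}) (4 + n)
intervalColour-noMonoChain {n} (f , _ , cf≡) = <⇒≱ (m<m+n (3 + n) ∣bottom∣>0)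
  (≤-trans (copy-grows f) (∣p∣≤n (⟦ fromℕ (3 + n) ⟧)))
  where
  open InducedCopy f

  coloured⇒∣∣>0 : (A : Subset (3 + n)) → intervalColour A ≢ 0F → 0 < ∣ A ∣
  coloured⇒∣∣>0 (a ∷ b ∷ A) cA≢0 = begin
    1                   ≤⟨ s≤s z≤n ⟩
    1 + n               ≡⟨ ∣⊤∣≡n (1 + n) ⟨
    ∣ ⊤ {1 + n} ∣       ≤⟨ p⊆q⇒∣p∣≤∣q∣ (coloured⇒⊤⊆ a b A cA≢0) ⟩
    ∣ A ∣               ≤⟨ ∣p∣≤∣x∷p∣ b A ⟩
    ∣ b ∷ A ∣           ≤⟨ ∣p∣≤∣x∷p∣ a (b ∷ A) ⟩
    ∣ a ∷ b ∷ A ∣       ∎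
    where open ℕₚ.≤-Reasoning

  top≡⊤ : ⟦ fromℕ (3 + n) ⟧ ≡ ⊤
  top≡⊤ = ∣p∣≥n⇒p≡⊤ (≤-trans (m≤m+n (3 + n) _) (copy-grows f))

  bottom-colour : intervalColour (⟦ zero ⟧) ≡ 3F
  bottom-colour = trans (trans (cf≡ zero) (sym (cf≡ (fromℕ (3 + n)))))
    (trans (cong intervalColour top≡⊤) (intervalColour-top true true (⊤ {1 + n}) ⊆⊤))

  ∣bottom∣>0 : 0 < ∣ ⟦ zero ⟧ ∣
  ∣bottom∣>0 = coloured⇒∣∣>0 (⟦ zero ⟧) λ c≡0 → contradiction (trans (sym bottom-colour) c≡0) λ ()

-- Gallai-Ramsey numbers and the three statements

GR-intro : ∀ {Q P} → N ≥ 1 → ¬ Unavoidable k Q P N → UnavoidableFrom k Q P (suc N) →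
               GR≡ k Q P (suc N)
GR-intro {N = N} N≥1 avoidable from =
  -- A single bad `N`, one below the claimed value, refutes goodness and also every threshold
  -- `m ≤ N`.
  (λ good → avoidable (good N N≥1)) ,
  from ,
  λ m fromₘ → ≰⇒> (λ m≤N → avoidable (fromₘ N N≥1 m≤N))

exact⇒rainbow-or : ∀ (c : Coloring (2 + m) N) → Exact c →
  (NoRainbow c → ProperFamily c m → HasMonoChain c t) →
  (∃[ f ] Rainbow c ∨₂ f) ⊎ HasMonoChain c t
exact⇒rainbow-or c exact mono with rainbow? c
... | inj₁ rainbow = inj₁ rainbow
... | inj₂ nr      = inj₂ (mono nr (exact⇒properFamily exact))

0≢1 : _≢_ {A = Fin (2 + m)} 0F 1F
0≢1 ()

theorem1p3 : ∀ (k s : ℕ) → k ≥ 3 → s ≥ 2 →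
    GR≡ 3 ∨₂ (𝓒 s) (2 * s ∸ 1)
    × ((s ≡ 2 ⊎ s ≡ 3 → Good 4 ∨₂ (𝓒 s)) × (s ≥ 4 → GR≡ 4 ∨₂ (𝓒 s) s))
    × (k ≥ 5 → Good k ∨₂ (𝓒 s))
theorem1p3 k (suc (suc r)) _ (s≤s (s≤s _)) = GR₃ , (good₄ , GR₄) , good₅ k
  where
  s = 2 + r

  GR₃ : GR≡ 3 ∨₂ (𝓒 s) (2 * s ∸ 1)
  -- The rewriting exhibits 2s - 1 as the successor of 2(s - 1), the size of the ground set for
  -- `sizeColour` with a = s - 1.
  GR₃ rewrite +-identityʳ r | +-suc r (1 + r) = GR-intro (s≤s z≤n)
    (avoiding (sizeColour (1 + r) (1 + r + (1 + r)))
      (sizeColour-exact (s≤s z≤n) (m≤n+m (1 + r) r))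
      sizeColour-noRainbow
      (sizeColour-noMonoChain (s≤s z≤n) ≤-refl))
    λ N _ N≥ c exact → exact⇒rainbow-or c exact λ nr F →
      twoColourChain nr F (subst (_≤ N) (sym (+-suc (1 + r) (1 + r))) N≥)

  good₄ : s ≡ 2 ⊎ s ≡ 3 → Good 4 ∨₂ (𝓒 s)
  good₄ s≡2,3 N _ c exact = exact⇒rainbow-or c exact λ nr F →
    -- The two family members already force `N` to be at least 3, hence at least `s`.
    familyChain nr F 0≢1 (≤-trans (s≤3 s≡2,3) (3≤N nr F 0≢1))
    where
    s≤3 : s ≡ 2 ⊎ s ≡ 3 → s ≤ 3
    s≤3 (inj₁ refl) = s≤s (s≤s z≤n)
    s≤3 (inj₂ refl) = ≤-refl

  GR₄ : s ≥ 4 → GR≡ 4 ∨₂ (𝓒 s) s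
  -- The bad ground set has s - 1 points, at least 3 of them, so removing two leaves a nonempty Z.
  GR₄ (s≤s (s≤s (s≤s (s≤s _)))) = GR-intro (s≤s z≤n)
    (avoiding intervalColour intervalColour-exact intervalColour-noRainbow intervalColour-noMonoChain)
    λ N _ N≥s c exact → exact⇒rainbow-or c exact λ nr F → familyChain nr F 0≢1 N≥s

  good₅ : ∀ k → k ≥ 5 → Good k ∨₂ (𝓒 s)
  good₅ _ (s≤s (s≤s (s≤s (s≤s (s≤s _))))) N _ c exact = exact⇒rainbow-or c exact λ nr F →
    -- At least five colours give a family of at least three members, so every exact colouring has a
    -- rainbow copy.
    ⊥-elim (¬three nr F {0F} {1F} {2F} (λ ()) (λ ()) (λ ()))
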